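{- For every graph $\mathcal{G}=(V,E)$ with diameter $2$ we have $$M(\mathcal{G})\ge\binom{\#V+1}{2}-\#E.$$
   Context: Graphs are finite, simple and undirected. The diameter of a connected graph is the maximum distance between pairs of vertices, where the distance is the length (number of edges) of a shortest path. For a graph $\mathcal{G}$ with $n$ vertices and adjacency matrix $A$, viewed over $\mathbb{F}_2$, let $C(\mathcal{G})\subseteq\mathbb{F}_2^{2n}$ be the binary linear code generated by the rows of $[I_n|A]$, where $I_n$ is the $n\times n$ identity matrix. The support of a vector is the set of positions of its nonzero entries. A nonzero codeword $c$ of a binary linear code $C$ is minimal if there is no nonzero codeword $c'\in C$ with $\operatorname{supp}(c')\subsetneq\operatorname{supp}(c)$. $M(\mathcal{G})$ denotes the number of minimal codewords of $C(\mathcal{G})$; it does not depend on the labeling of the vertices. -}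

module Defs where

open import Algebra.Bundles using (module CommutativeRing)
import Algebra.Properties.Semiring.Sum as Sum
open import Data.Bool.Base using (Bool; true; false; _∧_)
import Data.Bool.Properties as Bool
open import Data.Fin.Base using (Fin)
import Data.Fin.Properties as Fin
open import Data.Fin.Subset using (Subset; _⊂_)
open import Data.Fin.Subset.Properties using (anySubset?; _⊂?_)
open import Data.List.Base
  using (List; []; _∷_; length; filter; allFin; cartesianProduct; cartesianProductWith)
open import Data.List.Relation.Unary.Unique.Propositional using (Unique)
open import Data.Nat.Base using (ℕ; zero; suc; _+_; _≤_)
open import Data.Product.Base using (∃; _×_; _,_)
open import Data.Vec.Base using (Vec; []; _∷_; lookup; tabulate; replicate)
open import Data.Vec.Functional using (_++_)
open import Data.Vec.Properties using (≡-dec)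
open import Level using (0ℓ)
open import Relation.Binary.Core using (Rel)
open import Relation.Binary.Definitions using (Decidable; Symmetric; Irreflexive)
open import Relation.Binary.PropositionalEquality.Core using (_≡_; _≢_)
open import Relation.Nullary.Decidable using (does; _×-dec_; ¬?)
open import Relation.Nullary.Negation using (¬_)
import Relation.Unary as U

-- The vertex set is Fin n; the number of minimal codewords below does not
-- depend on the choice of labelling.

record Graph (n : ℕ) : Set₁ where
  infix 4 _~_ _~?_
  field
    _~_    : Rel (Fin n) 0ℓ
    _~?_   : Decidable _~_
    sym    : Symmetric _~_
    irrefl : Irreflexive _≡_ _~_

module _ {n : ℕ} (G : Graph n) where
  open Graph G

  -- Each edge {u , v} is counted once, as the ordered pair with u < v.

  #E : ℕ
  #E = length (filter (λ (u , v) → (u Fin.<? v) ×-dec (u ~? v))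
                      (cartesianProduct (allFin n) (allFin n)))

  data Walk : Fin n → Fin n → Set where
    nil  : ∀ {u} → Walk u u
    cons : ∀ {u v w} → u ~ v → Walk v w → Walk u w

  vertices : ∀ {u v} → Walk u v → List (Fin n)
  vertices {u} nil        = u ∷ []
  vertices {u} (cons _ p) = u ∷ vertices p

  walkLength : ∀ {u v} → Walk u v → ℕ
  walkLength nil        = 0
  walkLength (cons _ p) = suc (walkLength p)

  IsPath : ∀ {u v} → Walk u v → Set
  IsPath p = Unique (vertices p)

  Connected : Set
  Connected = ∀ u v → ∃ λ (p : Walk u v) → IsPath p

  IsDistance : Fin n → Fin n → ℕ → Set
  IsDistance u v d =
    (∃ λ (p : Walk u v) → IsPath p × walkLength p ≡ d) ×
    (∀ (p : Walk u v) → IsPath p → d ≤ walkLength p)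

  HasDiameter : ℕ → Set
  HasDiameter k =
    Connected ×
    (∃ λ u → ∃ λ v → IsDistance u v k) ×
    (∀ u v d → IsDistance u v d → d ≤ k)

-- 𝔽₂ is Bool with _xor_ as addition and _∧_ as multiplication; ∑ is the
-- resulting sum over Fin k → Bool.

open Sum (CommutativeRing.semiring Bool.xor-∧-commutativeRing)
  using () renaming (sum to ∑)

Word : ℕ → Set
Word m = Vec Bool m

0w : ∀ {m} → Word m
0w = replicate _ false

Matrix : ℕ → ℕ → Set
Matrix k m = Fin k → Fin m → Bool

Code : ℕ → Set₁
Code m = U.Pred (Word m) 0ℓ

combination : ∀ {k m} → Matrix k m → Word k → Word m
combination R x = tabulate λ j → ∑ λ i → lookup x i ∧ R i j

generatedBy : ∀ {k m} → Matrix k m → Code m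
generatedBy R c = ∃ λ x → combination R x ≡ c

-- A subset of Fin m is its Bool-valued indicator vector, so a binary word
-- literally is its own support.

supp : ∀ {m} → Word m → Subset m
supp c = c

IsMinimal : ∀ {m} → Code m → Word m → Set
IsMinimal C c =
  C c × c ≢ 0w × ¬ (∃ λ c′ → C c′ × c′ ≢ 0w × supp c′ ⊂ supp c)

_≟w_ : ∀ {m} → Decidable {A = Word m} _≡_
_≟w_ = ≡-dec Bool._≟_

generatedBy? : ∀ {k m} (R : Matrix k m) → U.Decidable (generatedBy R)
generatedBy? R c = anySubset? λ x → combination R x ≟w c

isMinimal? : ∀ {m} {C : Code m} → U.Decidable C → U.Decidable (IsMinimal C)
isMinimal? C? c =
  C? c ×-dec ¬? (c ≟w 0w) ×-dec
  ¬? (anySubset? λ c′ → C? c′ ×-dec ¬? (c′ ≟w 0w) ×-dec (supp c′ ⊂? supp c))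

allWords : ∀ m → List (Word m)
allWords zero    = [] ∷ []
allWords (suc m) = cartesianProductWith _∷_ (false ∷ true ∷ []) (allWords m)

#minimal : ∀ {m} {C : Code m} → U.Decidable C → ℕ
#minimal {m} C? = length (filter (isMinimal? C?) (allWords m))

identityMatrix : ∀ n → Matrix n n
identityMatrix n i j = does (i Fin.≟ j)

adjacencyMatrix : ∀ {n} → Graph n → Matrix n n
adjacencyMatrix G i j = does (Graph._~?_ G i j)

[I∣A] : ∀ {n} → Graph n → Matrix n (n + n)
[I∣A] {n} G i = identityMatrix n i ++ adjacencyMatrix G i

graphCode : ∀ {n} → Graph n → Code (n + n)
graphCode G = generatedBy ([I∣A] G)

M : ∀ {n} → Graph n → ℕ
M G = #minimal {C = graphCode G} (generatedBy? ([I∣A] G))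

module Submission where

-- Write c(S) for the codeword obtained by adding the rows of [I|A] indexed by
-- a vertex set S.  Its left half is S itself, so a codeword c(T) with support
-- inside that of c(S) has T ⊆ S.  Two kinds of sets therefore give minimal
-- codewords:
--
--  * singletons {u}, as T ⊆ {u} forces T to be empty or all of {u};
--  * pairs {u , v} with a common neighbour w, as the remaining candidates
--    c({u}) and c({v}) have a one at w in the right half, where the two ones
--    of the summands of c({u , v}) cancel.
--
-- Both are covered by `pair-minimal`, a singleton being the pair {u , u}.
-- In a graph of diameter two any two distinct non-adjacent vertices have a
-- common neighbour (`common-neighbour`), so every pair u ≤ v with u and v not
-- adjacent contributes a minimal codeword, and these are distinct because the
-- left half recovers the pair.  There are "n + 1 choose 2" pairs u ≤ v, of
-- which the adjacent ones are the edges; the count follows.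

open import Defs
open import Data.Nat.Base using (ℕ; suc; _∸_; _≥_)
open import Data.Nat.Combinatorics using (_C_)

open import Algebra.Bundles using (module CommutativeRing)
import Algebra.Properties.Semiring.Sum as Sum
open import Data.Bool.Base using (Bool; true; false; _∧_; _xor_)
import Data.Bool.Properties as Bool
open import Data.Fin.Base as Fin using (Fin; zero; suc; _↑ˡ_; _↑ʳ_)
import Data.Fin.Properties as Fin
open import Data.Fin.Subset using (Subset; _∈_; _∉_; _⊆_; ⁅_⁆; _∪_)
open import Data.Fin.Subset.Properties
  using ( _∈?_; Empty-unique; x∈⁅x⁆; x∈⁅y⁆⇒x≡y; x∈p∪q⁺; x∈p∪q⁻; ∪-comm
        ; ⊆-antisym; ⊆-reflexive)
open import Data.List.Base
  using (List; []; _∷_; _++_; map; length; filter; allFin)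
import Data.List.Base as List
open import Data.List.Membership.Propositional using () renaming (_∈_ to _∈ˡ_)
open import Data.List.Membership.Propositional.Properties
  using ( ∈-allFin; ∈-cartesianProduct⁺; ∈-cartesianProductWith⁺; ∈-filter⁺
        ; ∈-filter⁻; ∈-lookup; ∈-map⁻; ∈-++⁻)
open import Data.List.Membership.Setoid.Properties using (index-injective)
open import Data.List.Properties using (length-++; length-map; length-tabulate)
open import Data.List.Relation.Unary.All as All using ()
open import Data.List.Relation.Unary.AllPairs using ([]; _∷_)
open import Data.List.Relation.Unary.Any using (here; there; index)
open import Data.List.Relation.Unary.Unique.Propositional using (Unique)
open import Data.List.Relation.Unary.Unique.Propositional.Properties
  using (map⁺; ++⁺; allFin⁺; filter⁺)
open import Data.Nat.Base using (zero; _+_; _≤_; _<_; z≤n; s≤s)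
open import Data.Nat.Combinatorics using (nC1≡n; nCk+nC[k+1]≡[n+1]C[k+1])
open import Data.Nat.Induction using (<-rec)
import Data.Nat.Properties as ℕ
open import Data.Product.Base using (∃; _×_; _,_; proj₁; proj₂; uncurry)
open import Data.Sum.Base using (_⊎_; inj₁; inj₂)
open import Data.Vec.Base using ([]; _∷_; lookup)
open import Data.Vec.Functional.Properties using (lookup-++ˡ; lookup-++ʳ)
open import Data.Vec.Properties
  using ([]=⇒lookup; lookup⇒[]=; lookup∘tabulate; lookup-replicate)
open import Function.Base using (_∘_; id)
open import Level using (0ℓ)
open import Relation.Binary.PropositionalEquality
  using (_≡_; _≢_; refl; sym; trans; cong; cong₂; subst; setoid; module ≡-Reasoning)
open import Relation.Nullary.Decidable
  using (Dec; yes; no; does; _×-dec_; ¬?; dec-true; dec-false; decidable-stable)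
open import Relation.Nullary.Negation using (¬_; contradiction)
import Relation.Unary as U

open Sum (CommutativeRing.semiring Bool.xor-∧-commutativeRing)
  using (sum-cong-≗; sum-replicate-zero) renaming (sum to ∑)

-- Counting with duplicate-free lists

Unique⇒lookup-injective : ∀ {A : Set} {xs : List A} → Unique xs →
  ∀ {i j} → List.lookup xs i ≡ List.lookup xs j → i ≡ j
Unique⇒lookup-injective (_ ∷ _)   {zero}  {zero}  _  = refl
Unique⇒lookup-injective (x∉ ∷ _)  {zero}  {suc j} eq =
  contradiction eq (All.lookup x∉ (∈-lookup j))
Unique⇒lookup-injective (x∉ ∷ _)  {suc i} {zero}  eq =
  contradiction (sym eq) (All.lookup x∉ (∈-lookup i))
Unique⇒lookup-injective (_ ∷ xs!) {suc i} {suc j} eq =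
  cong suc (Unique⇒lookup-injective xs! eq)

injection⇒length≤ : ∀ {A B : Set} {xs : List A} {ys : List B} (f : A → B) →
  Unique xs →
  (∀ {x} → x ∈ˡ xs → f x ∈ˡ ys) →
  (∀ {x y} → x ∈ˡ xs → y ∈ˡ xs → f x ≡ f y → x ≡ y) →
  length xs ≤ length ys
injection⇒length≤ {B = B} f xs! f∈ f-inj =
  Fin.injective⇒≤ {f = λ i → index (f∈ (∈-lookup i))} λ {i} {j} eq →
    Unique⇒lookup-injective xs!
      (f-inj (∈-lookup i) (∈-lookup j)
        (index-injective (setoid B) (f∈ (∈-lookup i)) (f∈ (∈-lookup j)) eq))

length-filter+¬filter : ∀ {A : Set} {P : U.Pred A 0ℓ} (P? : U.Decidable P) xs →
  length (filter (¬? ∘ P?) xs) + length (filter P? xs) ≡ length xs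
length-filter+¬filter P? [] = refl
length-filter+¬filter P? (x ∷ xs) with does (P? x)
... | true  = trans (ℕ.+-suc _ _) (cong suc (length-filter+¬filter P? xs))
... | false = cong suc (length-filter+¬filter P? xs)

∈-allWords : ∀ {m} (c : Word m) → c ∈ˡ allWords m
∈-allWords []       = here refl
∈-allWords (b ∷ bs) = ∈-cartesianProductWith⁺ _∷_ (∈-bits b) (∈-allWords bs)
  where
  ∈-bits : ∀ b → b ∈ˡ false ∷ true ∷ []
  ∈-bits false = here refl
  ∈-bits true  = there (here refl)

-- Ordered pairs of vertices

-- All pairs (u , v) in Fin n with u ≤ v: those with u ≡ zero, then the shifts by
-- one of the pairs of the next smaller size.
upperPairs : ∀ n → List (Fin n × Fin n)
upperPairs zero    = []
upperPairs (suc n) =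
  map (zero ,_) (allFin (suc n)) ++ map (λ (u , v) → suc u , suc v) (upperPairs n)

length-upperPairs : ∀ n → length (upperPairs n) ≡ suc n C 2
length-upperPairs zero    = refl
length-upperPairs (suc n) = begin
  length (upperPairs (suc n))
    ≡⟨ length-++ (map (zero ,_) (allFin (suc n))) ⟩
  length (map (zero {n} ,_) (allFin (suc n))) + length (map _ (upperPairs n))
    ≡⟨ cong₂ _+_ (trans (length-map _ (allFin (suc n))) (length-tabulate {n = suc n} id))
                 (trans (length-map _ (upperPairs n)) (length-upperPairs n)) ⟩
  suc n + suc n C 2
    ≡⟨ cong (_+ suc n C 2) (nC1≡n (suc n)) ⟨
  suc n C 1 + suc n C 2
    ≡⟨ nCk+nC[k+1]≡[n+1]C[k+1] (suc n) 1 ⟩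
  suc (suc n) C 2 ∎
  where open ≡-Reasoning

upperPairs⁺ : ∀ n → Unique (upperPairs n)
upperPairs⁺ zero    = []
upperPairs⁺ (suc n) =
  ++⁺ (map⁺ (λ { refl → refl }) (allFin⁺ (suc n)))
      (map⁺ {f = λ (u , v) → suc u , suc v} (λ { refl → refl }) (upperPairs⁺ n))
      disjoint
  where
  disjoint : ∀ {p} → ¬ (p ∈ˡ map (zero ,_) (allFin (suc n)) ×
                        p ∈ˡ map (λ (u , v) → suc u , suc v) (upperPairs n))
  disjoint (p∈ , q∈) with ∈-map⁻ _ p∈ | ∈-map⁻ _ q∈
  ... | _ , _ , refl | _ , _ , ()

∈-upperPairs⇒≤ : ∀ {n} {u v : Fin n} → (u , v) ∈ˡ upperPairs n → u Fin.≤ v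
∈-upperPairs⇒≤ {suc n} p∈ with ∈-++⁻ (map (zero ,_) (allFin (suc n))) p∈
... | inj₁ q∈ with ∈-map⁻ _ q∈
...   | _ , _ , refl = z≤n
∈-upperPairs⇒≤ {suc n} p∈ | inj₂ q∈ with ∈-map⁻ _ q∈
...   | _ , r∈ , refl = s≤s (∈-upperPairs⇒≤ r∈)

-- The set {u , v}, which is a singleton when u ≡ v.
pair : ∀ {n} → Fin n → Fin n → Subset n
pair u v = ⁅ u ⁆ ∪ ⁅ v ⁆

module _ {n : ℕ} {u v : Fin n} where

  ∈-pair⁻ : ∀ {i} → i ∈ pair u v → i ≡ u ⊎ i ≡ v
  ∈-pair⁻ i∈ with x∈p∪q⁻ ⁅ u ⁆ ⁅ v ⁆ i∈
  ... | inj₁ i∈u = inj₁ (x∈⁅y⁆⇒x≡y u i∈u)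
  ... | inj₂ i∈v = inj₂ (x∈⁅y⁆⇒x≡y v i∈v)

  ∈-pairˡ : u ∈ pair u v
  ∈-pairˡ = x∈p∪q⁺ (inj₁ (x∈⁅x⁆ u))

  ∈-pairʳ : v ∈ pair u v
  ∈-pairʳ = x∈p∪q⁺ (inj₂ (x∈⁅x⁆ v))

pair-injective : ∀ {n} {u v u′ v′ : Fin n} → u Fin.≤ v → u′ Fin.≤ v′ →
  pair u v ≡ pair u′ v′ → (u , v) ≡ (u′ , v′)
pair-injective {u = u} {v} {u′} {v′} u≤v u′≤v′ eq
  with ∈-pair⁻ (subst (u ∈_) eq ∈-pairˡ) | ∈-pair⁻ (subst (v ∈_) eq ∈-pairʳ)
     | ∈-pair⁻ (subst (u′ ∈_) (sym eq) ∈-pairˡ) | ∈-pair⁻ (subst (v′ ∈_) (sym eq) ∈-pairʳ)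
... | inj₁ refl | inj₂ refl | _         | _         = refl
... | inj₂ refl | inj₁ refl | _         | _         = cong₂ _,_ u≡v (sym u≡v)
  where u≡v = Fin.≤-antisym u≤v u′≤v′
... | inj₁ refl | inj₁ refl | _         | inj₁ refl = refl
... | inj₁ refl | inj₁ refl | _         | inj₂ refl = refl
... | inj₂ refl | inj₂ refl | inj₁ refl | _         = refl
... | inj₂ refl | inj₂ refl | inj₂ refl | _         = refl

-- Sums over 𝔽₂ with at most two nonzero terms

∑-zero : ∀ {n} {f : Fin n → Bool} → (∀ i → f i ≡ false) → ∑ f ≡ false
∑-zero {n} f≡0 = trans (sum-cong-≗ f≡0) (sum-replicate-zero n)

∑-single : ∀ {n} {f : Fin n → Bool} u → (∀ i → i ≢ u → f i ≡ false) → ∑ f ≡ f u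
∑-single {f = f} zero f≡0 =
  trans (cong (f zero xor_) (∑-zero λ i → f≡0 (suc i) λ ())) (Bool.xor-identityʳ _)
∑-single {f = f} (suc u) f≡0 =
  cong₂ _xor_ (f≡0 zero λ ()) (∑-single u λ i i≢u → f≡0 (suc i) (i≢u ∘ Fin.suc-injective))

∑-double : ∀ {n} {f : Fin n → Bool} {u v} → u ≢ v →
  (∀ i → i ≢ u → i ≢ v → f i ≡ false) → ∑ f ≡ f u xor f v
∑-double {u = zero}  {zero}  u≢v f≡0 = contradiction refl u≢v
∑-double {f = f} {zero}  {suc v} u≢v f≡0 =
  cong (f zero xor_) (∑-single v λ i i≢v → f≡0 (suc i) (λ ()) (i≢v ∘ Fin.suc-injective))
∑-double {f = f} {suc u} {zero}  u≢v f≡0 =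
  trans (cong (f zero xor_) (∑-single u λ i i≢u → f≡0 (suc i) (i≢u ∘ Fin.suc-injective) λ ()))
        (Bool.xor-comm (f zero) (f (suc u)))
∑-double {u = suc u} {suc v} u≢v f≡0 =
  cong₂ _xor_ (f≡0 zero (λ ()) λ ())
    (∑-double (u≢v ∘ cong suc) λ i i≢u i≢v →
      f≡0 (suc i) (i≢u ∘ Fin.suc-injective) (i≢v ∘ Fin.suc-injective))

∉⇒lookup≡false : ∀ {n} {x : Subset n} {i} → i ∉ x → lookup x i ≡ false
∉⇒lookup≡false {x = x} {i} i∉x = Bool.¬-not (i∉x ∘ lookup⇒[]= i x)

module _ {n : ℕ} (G : Graph n) where
  open Graph G renaming (sym to ~-sym)

-- Codewords of the graph code

  -- The sum c(x) of the rows of [I|A] indexed by the vertex set x.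
  codeword : Subset n → Word (n + n)
  codeword = combination ([I∣A] G)

  lookup-codewordˡ : ∀ x i → lookup (codeword x) (i ↑ˡ n) ≡ lookup x i
  lookup-codewordˡ x i = begin
    lookup (codeword x) (i ↑ˡ n)
      ≡⟨ lookup∘tabulate _ (i ↑ˡ n) ⟩
    ∑ (λ k → lookup x k ∧ [I∣A] G k (i ↑ˡ n))
      ≡⟨ sum-cong-≗ (λ k → cong (lookup x k ∧_)
           (lookup-++ˡ (identityMatrix n k) (adjacencyMatrix G k) i)) ⟩
    ∑ (λ k → lookup x k ∧ does (k Fin.≟ i))
      ≡⟨ ∑-single i (λ k k≢i → trans (cong (lookup x k ∧_) (dec-false (k Fin.≟ i) k≢i))
                                     (Bool.∧-zeroʳ _)) ⟩
    lookup x i ∧ does (i Fin.≟ i)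
      ≡⟨ trans (cong (lookup x i ∧_) (dec-true (i Fin.≟ i) refl)) (Bool.∧-identityʳ _) ⟩
    lookup x i ∎
    where open ≡-Reasoning

  lookup-codewordʳ : ∀ x w →
    lookup (codeword x) (n ↑ʳ w) ≡ ∑ (λ k → lookup x k ∧ does (k ~? w))
  lookup-codewordʳ x w =
    trans (lookup∘tabulate _ (n ↑ʳ w))
          (sum-cong-≗ λ k → cong (lookup x k ∧_)
            (lookup-++ʳ (identityMatrix n k) (adjacencyMatrix G k) w))

  codeword-reflects-⊆ : ∀ {x y} → codeword x ⊆ codeword y → x ⊆ y
  codeword-reflects-⊆ {x} {y} cx⊆cy {i} i∈x =
    lookup⇒[]= i y (trans (sym (lookup-codewordˡ y i)) ([]=⇒lookup (cx⊆cy
      (lookup⇒[]= (i ↑ˡ n) (codeword x) (trans (lookup-codewordˡ x i) ([]=⇒lookup i∈x))))))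

  codeword-injective : ∀ {x y} → codeword x ≡ codeword y → x ≡ y
  codeword-injective eq = ⊆-antisym (codeword-reflects-⊆ (⊆-reflexive eq))
                                    (codeword-reflects-⊆ (⊆-reflexive (sym eq)))

  codeword-empty : ∀ {x} → (∀ i → i ∉ x) → codeword x ≡ 0w
  codeword-empty {x} i∉x = Empty-unique empty
    where
    empty : ¬ ∃ (_∈ codeword x)
    empty (j , j∈) = Bool.not-¬
      (trans (sym (lookup∘tabulate _ j)) ([]=⇒lookup j∈))
      (∑-zero λ k → cong (_∧ [I∣A] G k j) (∉⇒lookup≡false (i∉x k)))

  CommonNeighbour : Fin n → Fin n → Set
  CommonNeighbour u v = ∃ λ w → u ~ w × v ~ w

  -- A set meeting {u , v} in u alone has a codeword not contained in
  -- c({u , v}): they differ at the right-hand position of a common neighbour.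
  half-pair-⊈ : ∀ {u v y} → CommonNeighbour u v → y ⊆ pair u v → u ∈ y → v ∉ y →
    ¬ (codeword y ⊆ codeword (pair u v))
  half-pair-⊈ {u} {v} {y} (w , u~w , v~w) y⊆ u∈y v∉y cy⊆ =
    contradiction (trans (sym at-pair) ([]=⇒lookup (cy⊆ (lookup⇒[]= _ _ at-y)))) λ ()
    where
    at : Subset n → Fin n → Bool
    at x k = lookup x k ∧ does (k ~? w)

    at-true : ∀ {x k} → k ∈ x → k ~ w → at x k ≡ true
    at-true k∈x k~w = cong₂ _∧_ ([]=⇒lookup k∈x) (dec-true (_ ~? w) k~w)

    at-false : ∀ {x k} → k ∉ x → at x k ≡ false
    at-false {k = k} k∉x = cong (_∧ does (k ~? w)) (∉⇒lookup≡false k∉x)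

    y-only-u : ∀ k → k ≢ u → k ∉ y
    y-only-u k k≢u k∈y with ∈-pair⁻ (y⊆ k∈y)
    ... | inj₁ k≡u  = k≢u k≡u
    ... | inj₂ refl = v∉y k∈y

    pair-only-uv : ∀ k → k ≢ u → k ≢ v → k ∉ pair u v
    pair-only-uv k k≢u k≢v k∈ with ∈-pair⁻ k∈
    ... | inj₁ k≡u = k≢u k≡u
    ... | inj₂ k≡v = k≢v k≡v

    at-y : lookup (codeword y) (n ↑ʳ w) ≡ true
    at-y = trans (lookup-codewordʳ y w)
      (trans (∑-single u λ k k≢u → at-false (y-only-u k k≢u)) (at-true u∈y u~w))

    at-pair : lookup (codeword (pair u v)) (n ↑ʳ w) ≡ false
    at-pair = trans (lookup-codewordʳ (pair u v) w)
      (trans (∑-double (λ { refl → v∉y u∈y })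
                       (λ k k≢u k≢v → at-false (pair-only-uv k k≢u k≢v)))
             (cong₂ _xor_ (at-true ∈-pairˡ u~w) (at-true (∈-pairʳ {u = u}) v~w)))

  pair-minimal : ∀ {u v} → u ≡ v ⊎ CommonNeighbour u v →
    IsMinimal (graphCode G) (codeword (pair u v))
  pair-minimal {u} {v} h = (pair u v , refl) , nonzero , smallest
    where
    nonzero : codeword (pair u v) ≢ 0w
    nonzero c≡0 = contradiction
      (trans (sym ([]=⇒lookup (∈-pairˡ {u = u} {v})))
        (trans (sym (lookup-codewordˡ (pair u v) u))
          (trans (cong (λ c → lookup c (u ↑ˡ n)) c≡0) (lookup-replicate (u ↑ˡ n) false))))
      λ ()

    smallest : ¬ (∃ λ c′ → graphCode G c′ × c′ ≢ 0w × _)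
    smallest (_ , (y , refl) , cy≢0 , cy⊆ , j , j∈ , j∉) = cases (u ∈? y) (v ∈? y) h
      where
      y⊆ : y ⊆ pair u v
      y⊆ = codeword-reflects-⊆ cy⊆

      cases : Dec (u ∈ y) → Dec (v ∈ y) → ¬ (u ≡ v ⊎ CommonNeighbour u v)
      cases (yes u∈y) (yes v∈y) _ =
        j∉ (subst (λ x → j ∈ codeword x) (⊆-antisym pair⊆y y⊆) j∈)
        where
        pair⊆y : pair u v ⊆ y
        pair⊆y i∈ with ∈-pair⁻ i∈
        ... | inj₁ refl = u∈y
        ... | inj₂ refl = v∈y
      cases (no u∉y) (no v∉y) _ = cy≢0 (codeword-empty i∉y)
        where
        i∉y : ∀ i → i ∉ y
        i∉y i i∈y with ∈-pair⁻ (y⊆ i∈y)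
        ... | inj₁ refl = u∉y i∈y
        ... | inj₂ refl = v∉y i∈y
      cases (yes u∈y) (no v∉y) (inj₁ refl) = v∉y u∈y
      cases (no u∉y) (yes v∈y) (inj₁ refl) = u∉y v∈y
      cases (yes u∈y) (no v∉y) (inj₂ cn) = half-pair-⊈ cn y⊆ u∈y v∉y cy⊆
      cases (no u∉y) (yes v∈y) (inj₂ (w , u~w , v~w)) =
        half-pair-⊈ (w , v~w , u~w)
          (subst (y ⊆_) swap-pair y⊆) v∈y u∉y
          (subst (λ x → codeword y ⊆ codeword x) swap-pair cy⊆)
        where
        swap-pair : pair u v ≡ pair v u
        swap-pair = ∪-comm ⁅ u ⁆ ⁅ v ⁆

-- Diameter two

  short-walk : ∀ {u v} (p : Walk G u v) → walkLength G p ≤ 2 →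
    u ≡ v ⊎ u ~ v ⊎ CommonNeighbour u v
  short-walk nil                            _ = inj₁ refl
  short-walk (cons u~v nil)                 _ = inj₂ (inj₁ u~v)
  short-walk (cons u~w (cons w~v nil))      _ = inj₂ (inj₂ (_ , u~w , ~-sym w~v))
  short-walk (cons _ (cons _ (cons _ _))) (s≤s (s≤s ()))

  -- If every walk from u to v were longer than any distance in the graph, then
  -- a path from u to v could not be shortest, and strong induction on the
  -- length would rule out all paths.
  no-path : (∀ u v d → IsDistance G u v d → d ≤ 2) →
    ∀ {u v} → (∀ (p : Walk G u v) → ¬ (walkLength G p ≤ 2)) →
    ∀ (p : Walk G u v) → ¬ IsPath G p
  no-path distance≤2 {u} {v} long p p! = <-rec NoPathOfLength step (walkLength G p) p p! refl
    where
    NoPathOfLength : ℕ → Set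
    NoPathOfLength k = ∀ (p : Walk G u v) → IsPath G p → walkLength G p ≢ k

    step : ∀ k → (∀ {j} → j < k → NoPathOfLength j) → NoPathOfLength k
    step k shorter p p! refl = long p (distance≤2 u v k
      ((p , p! , refl) , λ q q! → ℕ.≮⇒≥ λ q<p → shorter q<p q q! refl))

  -- The proof by contradiction avoids computing the distance, and is
  -- constructively sound as having a common neighbour is decidable.
  common-neighbour : HasDiameter G 2 → ∀ {u v} → ¬ (u ~ v) →
    u ≡ v ⊎ CommonNeighbour u v
  common-neighbour (connected , _ , distance≤2) {u} {v} u≁v with u Fin.≟ v
  ... | yes u≡v = inj₁ u≡v
  ... | no  u≢v = inj₂ (decidable-stable
    (Fin.any? λ w → (u ~? w) ×-dec (v ~? w)) λ no-neighbour →
      uncurry (no-path distance≤2 (long no-neighbour)) (connected u v))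
    where
    long : ¬ CommonNeighbour u v → (p : Walk G u v) → ¬ (walkLength G p ≤ 2)
    long no-neighbour p p≤2 with short-walk p p≤2
    ... | inj₁ u≡v        = u≢v u≡v
    ... | inj₂ (inj₁ u~v) = u≁v u~v
    ... | inj₂ (inj₂ cn)  = no-neighbour cn

-- Counting the pairs u ≤ v

  adjacent? : U.Decidable (uncurry _~_)
  adjacent? (u , v) = u ~? v

  #adjacent≤#E : length (filter adjacent? (upperPairs n)) ≤ #E G
  #adjacent≤#E = injection⇒length≤ id
    (filter⁺ adjacent? (upperPairs⁺ n)) is-edge (λ _ _ → id)
    where
    is-edge : ∀ {p} → p ∈ˡ filter adjacent? (upperPairs n) → p ∈ˡ _
    is-edge {u , v} p∈ with ∈-filter⁻ adjacent? p∈
    ... | p∈upper , u~v = ∈-filter⁺ _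
      (∈-cartesianProduct⁺ (∈-allFin u) (∈-allFin v))
      (Fin.≤∧≢⇒< (∈-upperPairs⇒≤ p∈upper) (λ u≡v → irrefl u≡v u~v) , u~v)

  #nonadjacent≤M : HasDiameter G 2 →
    length (filter (¬? ∘ adjacent?) (upperPairs n)) ≤ M G
  #nonadjacent≤M diameter-2 = injection⇒length≤ (codeword ∘ uncurry pair)
    (filter⁺ (¬? ∘ adjacent?) (upperPairs⁺ n)) is-minimal injective
    where
    is-minimal : ∀ {p} → p ∈ˡ filter (¬? ∘ adjacent?) (upperPairs n) →
      codeword (uncurry pair p) ∈ˡ filter (isMinimal? (generatedBy? ([I∣A] G))) (allWords (n + n))
    is-minimal p∈ = ∈-filter⁺ _ (∈-allWords _)
      (pair-minimal (common-neighbour diameter-2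
        (proj₂ (∈-filter⁻ (¬? ∘ adjacent?) {xs = upperPairs n} p∈))))

    upper : ∀ {p} → p ∈ˡ filter (¬? ∘ adjacent?) (upperPairs n) → uncurry Fin._≤_ p
    upper p∈ = ∈-upperPairs⇒≤ (proj₁ (∈-filter⁻ (¬? ∘ adjacent?) p∈))

    injective : ∀ {p q} → p ∈ˡ _ → q ∈ˡ _ →
      codeword (uncurry pair p) ≡ codeword (uncurry pair q) → p ≡ q
    injective p∈ q∈ eq = pair-injective (upper p∈) (upper q∈) (codeword-injective eq)

corollary2p8 : ∀ {n : ℕ} (G : Graph n) → HasDiameter G 2 → M G ≥ (suc n C 2) ∸ #E G
corollary2p8 {n} G diameter-2 = ℕ.m≤n+o⇒m∸n≤o (suc n C 2) (#E G) (begin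
  suc n C 2
    ≡⟨ length-upperPairs n ⟨
  length (upperPairs n)
    ≡⟨ length-filter+¬filter (adjacent? G) (upperPairs n) ⟨
  length (filter (¬? ∘ adjacent? G) (upperPairs n)) + length (filter (adjacent? G) (upperPairs n))
    ≡⟨ ℕ.+-comm (length (filter (¬? ∘ adjacent? G) (upperPairs n))) _ ⟩
  length (filter (adjacent? G) (upperPairs n)) + length (filter (¬? ∘ adjacent? G) (upperPairs n))
    ≤⟨ ℕ.+-mono-≤ (#adjacent≤#E G) (#nonadjacent≤M G diameter-2) ⟩
  #E G + M G ∎)
  where open ℕ.≤-Reasoning
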